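{- For all integers $n\ge 0$, $$F_{n+1}^2=T_n+\sum_{k=2}^n\sum_{j=1}^{\lfloor k/2\rfloor}(2+\delta_{j,1})F^2_{k-2j+1}T_{n-k},$$ where $T_n$ is the number of ways to tile an $n$-board using half-squares and $(\frac12,\frac12)$-fences such that no even-length metatiles occur.
   Context: The Fibonacci numbers are $F_0=0$, $F_1=1$, $F_n=F_{n-1}+F_{n-2}$ for $n\ge2$. $\delta_{i,j}$ is $1$ if $i=j$ and $0$ otherwise. Empty sums are $0$. An $n$-board is a $1\times n$ array of $n$ unit square cells in a row (horizontal extent $[0,n]$). A half-square is a tile of width $\frac12$ and height $1$, covering a horizontal interval $[x,x+\frac12]$. A $(\frac12,\frac12)$-fence is a single tile composed of two pieces (posts), each of width $\frac12$ and height $1$, separated by a gap of width $\frac12$; it covers $[x,x+\frac12]\cup[x+1,x+\frac32]$ for some $x$. Tiles are not rotated. Tiles need not be aligned with the cell boundaries, and the gap of a fence must be covered by other tiles. A tiling covers the board exactly, with no overlaps (of interiors), no uncovered region and nothing protruding from the board. There is exactly one (empty) tiling of the $0$-board. A metatile is a minimal (nonempty) arrangement of tiles that exactly covers an integral number of adjacent cells, that number being its length; every tiling of a board is uniquely a concatenation of metatiles. The numbers $T_n$ satisfy $T_0=T_1=T_2=1$ and $T_n=T_{n-1}+T_{n-2}+T_{n-3}$ for $n\ge3$.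
   Formalization: The horizontal positions x of the half-squares and fences, and the points of the board that must be covered, range over rational numbers instead of real numbers. -}

module Defs where

open import Data.Bool using (if_then_else_)
open import Data.Integer using (+_)
open import Data.List using (List; []; _∷_; length; map; sum; upTo)
open import Data.List.Membership.Propositional using (_∈_)
open import Data.List.Relation.Binary.Sublist.Propositional using (_⊆_)
open import Data.List.Relation.Unary.All using (All)
open import Data.List.Relation.Unary.AllPairs using (AllPairs)
open import Data.List.Relation.Unary.Any using (Any)
open import Data.List.Relation.Unary.Unique.Propositional using (Unique)
open import Data.Nat using (ℕ; zero; suc; _+_; _∸_; _≡ᵇ_)
open import Data.Nat.Divisibility using (_∣_)
open import Data.Product using (_×_; ∃; ∃-syntax)
open import Data.Rational as ℚ using (ℚ; ½; 1ℚ; _/_)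
open import Function.Bundles using (_⇔_)
open import Relation.Binary.PropositionalEquality using (_≡_; _≢_)
open import Relation.Nullary using (¬_)

F : ℕ → ℕ
F zero          = 0
F (suc zero)    = 1
F (suc (suc n)) = F (suc n) + F n

T : ℕ → ℕ
T zero                = 1
T (suc zero)          = 1
T (suc (suc zero))    = 1
T (suc (suc (suc n))) = T (suc (suc n)) + T (suc n) + T n

δ : ℕ → ℕ → ℕ
δ i j = if i ≡ᵇ j then 1 else 0

-- Both bounds are inclusive; the sum is empty when b < a.
∑ : ℕ → ℕ → (ℕ → ℕ) → ℕ
∑ a b f = sum (map (λ i → f (a + i)) (upTo (suc b ∸ a)))

infix 5 ∑
syntax ∑ a b (λ k → e) = ∑[ k from a to b ] e

-- x is the left end of the tile. It is an arbitrary rational: no alignment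
-- to cells or half-cells is built in.
data Tile : Set where
  halfSquare : (x : ℚ) → Tile
  fence      : (x : ℚ) → Tile

leftEnd : Tile → ℚ
leftEnd (halfSquare x) = x
leftEnd (fence x)      = x

-- Left ends of the width-½ pieces making up a tile.
pieces : Tile → List ℚ
pieces (halfSquare x) = x ∷ []
pieces (fence x)      = x ∷ (x ℚ.+ 1ℚ) ∷ []

Covers : Tile → ℚ → Set
Covers t y = Any (λ p → p ℚ.≤ y × y ℚ.≤ p ℚ.+ ½) (pieces t)

CoversInterior : Tile → ℚ → Set
CoversInterior t y = Any (λ p → p ℚ.< y × y ℚ.< p ℚ.+ ½) (pieces t)

fromℕ : ℕ → ℚ
fromℕ n = + n / 1

-- The tiles in ts exactly cover the interval [a , b]. Listing tiles by
-- strictly increasing left end makes each set of tiles correspond to a single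
-- list; no tiling is lost, as tiles with equal left ends overlap.
-- `filled` concerns the open interval only, so that [] exactly covers [a , a];
-- for a < b it is equivalent to covering the closed interval, because the
-- tiles are closed and finite in number.
record ExactlyCovers (a b : ℕ) (ts : List Tile) : Set where
  field
    ordered   : AllPairs (λ s t → leftEnd s ℚ.< leftEnd t) ts
    disjoint  : AllPairs (λ s t → ∀ y → ¬ (CoversInterior s y × CoversInterior t y)) ts
    contained : All (λ t → ∀ y → Covers t y → fromℕ a ℚ.≤ y × y ℚ.≤ fromℕ b) ts
    filled    : ∀ y → fromℕ a ℚ.< y → y ℚ.< fromℕ b → Any (λ t → Covers t y) ts

IsTiling : ℕ → List Tile → Set
IsTiling n ts = ExactlyCovers 0 n ts

CoversCells : ℕ → List Tile → Set
CoversCells l ts = ∃[ a ] ExactlyCovers a (a + l) ts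

record IsMetatile (l : ℕ) (ts : List Tile) : Set where
  field
    nonempty    : ts ≢ []
    coversCells : CoversCells l ts
    minimal     : ∀ ss → ss ⊆ ts → ss ≢ [] → ∃ (λ m → CoversCells m ss) → ss ≡ ts

NoEvenMetatile : List Tile → Set
NoEvenMetatile ts = ∀ l ms → ms ⊆ ts → IsMetatile l ms → ¬ (2 ∣ l)

-- Exactly m elements satisfy P. (Compares elements only, not proofs of P.)
HasCount : {A : Set} → (A → Set) → ℕ → Set
HasCount P m = ∃[ xs ] (Unique xs × (∀ x → x ∈ xs ⇔ P x) × length xs ≡ m)

{-# OPTIONS --safe #-}
module Submission where

-- The leftmost uncovered point of a partly tiled board must be the left end of
-- the next tile, so all left ends are multiples of 1/2 and a tiling is a run of
-- an automaton reading half-cells. A fence joins equal halves of adjacent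
-- cells, so a cell boundary is crossed by 0, 1 or 2 fences, and metatiles are
-- the runs between boundaries crossed by none: one of length 1, three of length
-- 2 and two of each length ≥ 3. With dₙ the number of ways to fill the last n
-- cells when a given post juts into them from a metatile of which an odd number
-- of cells is done, the tilings without even metatiles satisfy
-- Cₙ₊₁ = Cₙ + 2dₙ and dₙ₊₂ = Cₙ + dₙ, whence Cₙ = Tₙ.
-- For the identity, with fₙ the square of Fₙ₊₁, both sides satisfy
-- xₙ₊₄ + fₙ = xₙ₊₃ + xₙ₊₂ + xₙ₊₁ + 3fₙ₊₂.

open import Data.Bool using (Bool; true; false)
open import Data.List using (List; []; _∷_; _++_; map; length; sum; applyUpTo)
open import Data.List.Membership.Propositional using (_∈_; find; lose)
open import Data.List.Membership.Propositional.Properties using (∈-map⁺; ∈-map⁻; ∈-++⁺ˡ; ∈-++⁺ʳ; ∈-++⁻)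
open import Data.List.Properties using (length-++; length-map; ∷-injectiveʳ; map-upTo)
open import Data.List.Relation.Binary.Disjoint.Propositional using (Disjoint)
open import Data.List.Relation.Unary.All as All using (All; []; _∷_)
open import Data.List.Relation.Unary.AllPairs using (AllPairs; []; _∷_)
open import Data.List.Relation.Unary.Any as Any using (Any; here; there)
open import Data.List.Relation.Unary.Unique.Propositional using (Unique)
import Data.List.Relation.Unary.Unique.Propositional.Properties as Unique
open import Data.Nat.Divisibility using (_∣_; divides)
open import Data.Nat.Tactic.RingSolver using (solve-∀)
open import Data.Parity.Base using (Parity; 0ℙ; 1ℙ; _⁻¹)
open import Data.Product using (_×_; _,_; ∃-syntax; proj₁; proj₂)
import Data.Rational as ℚ
import Data.Rational.Properties as ℚ
open import Data.Sum using (_⊎_; inj₁; inj₂; [_,_]′)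
open import Function using (_∘_; id)
open import Function.Bundles using (_⇔_; mk⇔; Equivalence)
open import Level using (0ℓ)
open import Relation.Binary.PropositionalEquality
open import Relation.Nullary using (¬_; yes; no; contradiction)
open import Relation.Unary using (Pred; U)
open import Defs

-- Tilings read half-cell by half-cell.

module HalfCells where

  open import Relation.Unary using (_⊆_)
  open import Data.Integer as ℤ using (+_)
  import Data.Integer.Properties as ℤ
  open import Data.Nat as ℕ using (ℕ; zero; suc; _*_; s≤s; z≤n)
  import Data.Nat.Properties as ℕ
  open import Data.Rational as ℚ using (ℚ; ½; 0ℚ; 1ℚ; _+_; _≤_; _<_; toℚᵘ)
  open import Data.Rational.Properties
  open import Data.Rational.Unnormalised as ℚᵘ using (mkℚᵘ; *≡*)
  import Data.Rational.Unnormalised.Properties as ℚᵘ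

  half : ℕ → ℚ
  half zero    = 0ℚ
  half (suc i) = half i + ½

  half-+1 : ∀ i → half (suc (suc i)) ≡ half i + 1ℚ
  half-+1 i = +-assoc (half i) ½ ½

  -- The fraction `+ n / 1` is normalised and does not compute for a variable `n`, so the sums are
  -- compared among unnormalised rationals.
  fromℕ-suc : ∀ n → fromℕ (suc n) ≡ fromℕ n + 1ℚ
  fromℕ-suc n = toℚᵘ-injective (begin
    toℚᵘ (fromℕ (suc n))          ≈⟨ toℚᵘ-fromℚᵘ (mkℚᵘ (+ suc n) 0) ⟩
    mkℚᵘ (+ suc n) 0              ≈⟨ *≡* (cong (ℤ._* + 1) numerators) ⟩
    mkℚᵘ (+ n) 0 ℚᵘ.+ mkℚᵘ (+ 1) 0  ≈⟨ ℚᵘ.+-congˡ (mkℚᵘ (+ 1) 0) (ℚᵘ.≃-sym (toℚᵘ-fromℚᵘ (mkℚᵘ (+ n) 0))) ⟩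
    toℚᵘ (fromℕ n) ℚᵘ.+ toℚᵘ 1ℚ   ≈⟨ toℚᵘ-homo-+ (fromℕ n) 1ℚ ⟨
    toℚᵘ (fromℕ n + 1ℚ)           ∎)
    where
    open ℚᵘ.≃-Reasoning
    numerators : + suc n ≡ + n ℤ.* + 1 ℤ.+ + 1 ℤ.* + 1
    numerators = sym (trans (cong (ℤ._+ + 1) (ℤ.*-identityʳ (+ n))) (cong +_ (ℕ.+-comm n 1)))

  fromℕ≡half : ∀ n → fromℕ n ≡ half (n * 2)
  fromℕ≡half zero    = refl
  fromℕ≡half (suc n) = trans (fromℕ-suc n) (trans (cong (_+ 1ℚ) (fromℕ≡half n)) (sym (half-+1 (n * 2))))

  private
    <⇒≱ : ∀ {p q} → p < q → ¬ (q ≤ p)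
    <⇒≱ p<q q≤p = <-irrefl refl (<-≤-trans p<q q≤p)

  <+½ : ∀ p → p < p + ½
  <+½ p = subst (_< p + ½) (+-identityʳ p) (+-monoʳ-< p (positive⁻¹ ½))

  ≤+½ : ∀ p → p ≤ p + ½
  ≤+½ p = <⇒≤ (<+½ p)

  half-mono-≤ : ∀ {i j} → i ℕ.≤ j → half i ≤ half j
  half-mono-≤ {zero}  {zero}  z≤n     = ≤-refl
  half-mono-≤ {zero}  {suc j} z≤n     = ≤-trans (half-mono-≤ (z≤n {j})) (≤+½ (half j))
  half-mono-≤ {suc i} {suc j} (s≤s p) = +-monoˡ-≤ ½ (half-mono-≤ p)

  half-mono-< : ∀ {i j} → i ℕ.< j → half i < half j
  half-mono-< {i} i<j = <-≤-trans (<+½ (half i)) (half-mono-≤ i<j)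

  half-cancel-≤ : ∀ {i j} → half i ≤ half j → i ℕ.≤ j
  half-cancel-≤ hi≤hj = ℕ.≮⇒≥ λ j<i → <⇒≱ (half-mono-< j<i) hi≤hj

  half-injective : ∀ {i j} → half i ≡ half j → i ≡ j
  half-injective eq = ℕ.≤-antisym (half-cancel-≤ (≤-reflexive eq)) (half-cancel-≤ (≤-reflexive (sym eq)))

  -- Overlap of single posts.

  InPost InPostInterior : ℚ → Pred ℚ 0ℓ
  InPost p y         = p ≤ y × y ≤ p + ½
  InPostInterior p y = p < y × y < p + ½

  PostsDisjoint : ℚ → ℚ → Set
  PostsDisjoint p q = ∀ y → ¬ (InPostInterior p y × InPostInterior q y)

  PostDisjoint : ℚ → Tile → Set
  PostDisjoint q t = ∀ y → ¬ (InPostInterior q y × CoversInterior t y)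

  postsDisjoint : ∀ {p q} → p + ½ ≤ q → PostsDisjoint p q
  postsDisjoint p+½≤q y ((_ , y<p+½) , (q<y , _)) = <⇒≱ (<-trans y<p+½ (≤-<-trans p+½≤q q<y)) ≤-refl

  -- Were `q < p + ½`, density would give a point strictly between them, interior to both posts.
  disjoint⇒≥ : ∀ {p q} → p ≤ q → PostsDisjoint p q → p + ½ ≤ q
  disjoint⇒≥ {p} {q} p≤q disj = ≮⇒≥ λ q<p+½ →
    let y , q<y , y<p+½ = <-dense q<p+½
    in disj y ((≤-<-trans p≤q q<y , y<p+½) , (q<y , <-≤-trans y<p+½ (+-monoˡ-≤ ½ p≤q)))

  interior⇒covers : ∀ {t y} → CoversInterior t y → Covers t y
  interior⇒covers = Any.map λ (p<y , y<p+½) → <⇒≤ p<y , <⇒≤ y<p+½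

  covers-leftEnd : ∀ t → Covers t (leftEnd t)
  covers-leftEnd (halfSquare x) = here (≤-refl , ≤+½ x)
  covers-leftEnd (fence x)      = here (≤-refl , ≤+½ x)

  covers⇒leftEnd≤ : ∀ t {y} → Covers t y → leftEnd t ≤ y
  covers⇒leftEnd≤ (halfSquare x) (here (x≤y , _))         = x≤y
  covers⇒leftEnd≤ (fence x)      (here (x≤y , _))         = x≤y
  covers⇒leftEnd≤ (fence x)      (there (here (x+1≤y , _))) =
    ≤-trans (subst (_≤ x + 1ℚ) (+-identityʳ x) (+-monoʳ-≤ x (nonNegative⁻¹ 1ℚ))) x+1≤y

  leftEnd∈pieces : ∀ t → leftEnd t ∈ pieces t
  leftEnd∈pieces (halfSquare _) = here refl
  leftEnd∈pieces (fence _)      = here refl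

  -- Each piece of `t` has its left end covered by `t`, hence not left of `q`, so `disjoint⇒≥`
  -- applies to the pieces one at a time.
  disjointPost⇒≥ : ∀ {q} t → PostDisjoint q t → (∀ y → Covers t y → q ≤ y) → ∀ y → Covers t y → q + ½ ≤ y
  disjointPost⇒≥ t disj q≤ y cov with find cov
  ... | p , p∈ , p≤y , _ = ≤-trans (disjoint⇒≥ (q≤ p (lose p∈ (≤-refl , ≤+½ p))) λ z (zq , zp) → disj z (zq , lose p∈ zp)) p≤y

  -- Partly tiled boards.

  -- ts is what is left to place from half i on; Q holds of the left ends of the
  -- posts beyond half i which belong to tiles already placed.
  record Partial (i e : ℕ) (Q : Pred ℚ 0ℓ) (ts : List Tile) : Set where
    field
      ordered   : AllPairs (λ s t → leftEnd s < leftEnd t) ts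
      disjoint  : AllPairs (λ s t → ∀ y → ¬ (CoversInterior s y × CoversInterior t y)) ts
      contained : All (λ t → ∀ y → Covers t y → half i ≤ y × y ≤ half e) ts
      filled    : ∀ y → half i < y → y < half e → (∃[ q ] Q q × InPost q y) ⊎ Any (λ t → Covers t y) ts
      apart     : All (λ t → ∀ q → Q q → PostDisjoint q t) ts
      fits      : ∀ q → Q q → q + ½ ≤ half e

  module _ {i e : ℕ} {Q Q′ : Pred ℚ 0ℓ} where

    -- The post at `half i` fills its half-cell, so tiles that lie right of `half i` and avoid this
    -- post lie right of `half (suc i)`.
    skip⇒ : ∀ {ts} → Q (half i) → Q′ ⊆ Q → (∀ {q} → Q q → q ≡ half i ⊎ Q′ q) →
            Partial i e Q ts → Partial (suc i) e Q′ ts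
    skip⇒ now Q′⊆Q split P = record
      { ordered   = ordered
      ; disjoint  = disjoint
      ; contained = All.zipWith
          (λ {t} (c , a) y cov → disjointPost⇒≥ t (a (half i) now) (λ z cz → proj₁ (c z cz)) y cov , proj₂ (c y cov))
          (contained , apart)
      ; filled    = λ y hi+½<y y<he → [ (λ (q , Qq , q≤y , y≤q+½) →
            [ (λ { refl → contradiction y≤q+½ (<⇒≱ hi+½<y) }) , (λ Q′q → inj₁ (q , Q′q , q≤y , y≤q+½)) ]′ (split Qq))
          , inj₂ ]′ (filled y (<-trans (<+½ (half i)) hi+½<y) y<he)
      ; apart     = All.map (λ a q Q′q → a q (Q′⊆Q Q′q)) apart
      ; fits      = λ q Q′q → fits q (Q′⊆Q Q′q)
      }
      where open Partial P

    skip⇐ : ∀ {ts} → suc i ℕ.≤ e → Q′ ⊆ Q → Q (half i) → (∀ {q} → Q q → q ≡ half i ⊎ Q′ q) →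
            Partial (suc i) e Q′ ts → Partial i e Q ts
    skip⇐ i<e Q′⊆Q now split P = record
      { ordered   = ordered
      ; disjoint  = disjoint
      ; contained = All.map (λ c y cov → ≤-trans (≤+½ (half i)) (proj₁ (c y cov)) , proj₂ (c y cov)) contained
      ; filled    = filled′
      ; apart     = All.zipWith (λ {t} (c , a) q Qq y (yq , yt) →
          [ (λ { refl → <⇒≱ (proj₂ yq) (proj₁ (c y (interior⇒covers {t} yt))) }) , (λ Q′q → a q Q′q y (yq , yt)) ]′ (split Qq))
          (contained , apart)
      ; fits      = λ q Qq → [ (λ { refl → half-mono-≤ i<e }) , fits q ]′ (split Qq)
      }
      where
      open Partial P
      filled′ : ∀ y → half i < y → y < half e → (∃[ q ] Q q × InPost q y) ⊎ Any (λ t → Covers t y) _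
      filled′ y hi<y y<he with y ≤? half (suc i)
      ... | yes y≤ = inj₁ (half i , now , <⇒≤ hi<y , y≤)
      ... | no  y≰ = [ (λ (q , Q′q , qy) → inj₁ (q , Q′⊆Q Q′q , qy)) , inj₂ ]′ (filled y (≰⇒> y≰) y<he)

  module _ {i e : ℕ} {Q : Pred ℚ 0ℓ} {t : Tile} where

    private
      Q⁺ : Pred ℚ 0ℓ
      Q⁺ q = q ∈ pieces t ⊎ Q q

    -- The posts of the first tile are handed over to the placed ones; the union of everything
    -- covered does not change.
    unload : ∀ {ts} → Partial i e Q (t ∷ ts) → Partial i e Q⁺ ts
    unload P with Partial.ordered P | Partial.disjoint P | Partial.contained P | Partial.apart P
    ... | o ∷ os | d ∷ ds | c ∷ cs | a ∷ as = record
      { ordered   = os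
      ; disjoint  = ds
      ; contained = cs
      ; filled    = λ y hi<y y<he → [ (λ (q , Qq , qy) → inj₁ (q , inj₂ Qq , qy)) , fromAny y ]′ (Partial.filled P y hi<y y<he)
      ; apart     = All.zipWith (λ (dᵤ , aᵤ) q → [ (λ q∈ y (yq , yu) → dᵤ y (lose q∈ yq , yu)) , aᵤ q ]′) (d , as)
      ; fits      = λ q → [ (λ q∈ → proj₂ (c (q + ½) (lose q∈ (≤+½ q , ≤-refl)))) , Partial.fits P q ]′
      }
      where
      fromAny : ∀ y → Any (λ s → Covers s y) (t ∷ _) → (∃[ q ] Q⁺ q × InPost q y) ⊎ Any (λ s → Covers s y) _
      fromAny y (here cov) with find cov
      ... | q , q∈ , qy = inj₁ (q , inj₁ q∈ , qy)
      fromAny y (there p) = inj₂ p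

    -- The order is recovered from disjointness: the other tiles start no earlier than `half i` and
    -- avoid the post there, so they start later.
    load : ∀ {ts} → leftEnd t ≡ half i → (∀ q → Q q → PostDisjoint q t) → Partial i e Q⁺ ts → Partial i e Q (t ∷ ts)
    load leftEnd≡ apartₜ P = record
      { ordered   = All.zipWith (λ {u} (c , a) → later u c a) (contained , apart) ∷ ordered
      ; disjoint  = All.map (λ a y (yt , yu) → let q , q∈ , qy = find yt in a q (inj₁ q∈) y (qy , yu)) apart ∷ disjoint
      ; contained = (λ y cov → subst (_≤ y) leftEnd≡ (covers⇒leftEnd≤ t cov) ,
                       (let q , q∈ , _ , y≤ = find cov in ≤-trans y≤ (fits q (inj₁ q∈)))) ∷ contained
      ; filled    = λ y hi<y y<he → [ toAny y , (λ p → inj₂ (there p)) ]′ (filled y hi<y y<he)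
      ; apart     = apartₜ ∷ All.map (λ a q Qq → a q (inj₂ Qq)) apart
      ; fits      = λ q Qq → fits q (inj₂ Qq)
      }
      where
      open Partial P
      toAny : ∀ y → (∃[ q ] Q⁺ q × InPost q y) → (∃[ q ] Q q × InPost q y) ⊎ Any (λ s → Covers s y) (t ∷ _)
      toAny y (q , inj₁ q∈ , qy) = inj₂ (here (lose q∈ qy))
      toAny y (q , inj₂ Qq , qy) = inj₁ (q , Qq , qy)
      later : ∀ u → (∀ y → Covers u y → half i ≤ y × y ≤ half e) → (∀ q → Q⁺ q → PostDisjoint q u) → leftEnd t < leftEnd u
      later u c a = <-≤-trans (<+½ (leftEnd t))
        (disjointPost⇒≥ u (a (leftEnd t) (inj₁ (leftEnd∈pieces t)))
          (λ y cov → subst (_≤ y) (sym leftEnd≡) (proj₁ (c y cov))) (leftEnd u) (covers-leftEnd u))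

    -- If the first tile started right of `half i`, so would all others, and points just right of
    -- `half i` would stay uncovered.
    head-leftEnd : ∀ {ts} → suc i ℕ.≤ e → (∀ q → Q q → half (suc i) ≤ q) → Partial i e Q (t ∷ ts) → leftEnd t ≡ half i
    head-leftEnd i<e Q≥ P with Partial.ordered P | Partial.contained P
    ... | o ∷ _ | c ∷ _ = ≤-antisym (≮⇒≥ uncovered) (proj₁ (c (leftEnd t) (covers-leftEnd t)))
      where
      uncovered : ¬ (half i < leftEnd t)
      -- The witness is taken below both `leftEnd t` and `half (suc i)`: the second bound keeps it
      -- clear of the posts already placed.
      uncovered hi<l with leftEnd t ≤? half (suc i)
      ... | yes l≤ = let y , hi<y , y<l = <-dense hi<l in
          [ (λ (q , Qq , q≤y , _) → <⇒≱ (<-≤-trans y<l (≤-trans l≤ (Q≥ q Qq))) q≤y)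
          , (λ { (here cov) → <⇒≱ y<l (covers⇒leftEnd≤ t cov)
               ; (there p) → let u , u∈ , cov = find p in <⇒≱ (<-trans y<l (All.lookup o u∈)) (covers⇒leftEnd≤ u cov) }) ]′
          (Partial.filled P y hi<y (<-≤-trans y<l (≤-trans l≤ (half-mono-≤ i<e))))
      ... | no  l≰ = let y , hi<y , y<hi+½ = <-dense (<+½ (half i)) in
          [ (λ (q , Qq , q≤y , _) → <⇒≱ (<-≤-trans y<hi+½ (Q≥ q Qq)) q≤y)
          , (λ { (here cov) → <⇒≱ (<-trans y<hi+½ (≰⇒> l≰)) (covers⇒leftEnd≤ t cov)
               ; (there p) → let u , u∈ , cov = find p in <⇒≱ (<-trans (<-trans y<hi+½ (≰⇒> l≰)) (All.lookup o u∈)) (covers⇒leftEnd≤ u cov) }) ]′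
          (Partial.filled P y hi<y (<-≤-trans y<hi+½ (half-mono-≤ i<e)))

  nonempty-filling : ∀ {i e Q} → suc i ℕ.≤ e → (∀ q → Q q → half (suc i) ≤ q) → ¬ Partial i e Q []
  nonempty-filling {i} i<e Q≥ P =
    let y , hi<y , y<hi+½ = <-dense (<+½ (half i)) in
    [ (λ (q , Qq , q≤y , _) → <⇒≱ (<-≤-trans y<hi+½ (Q≥ q Qq)) q≤y) , (λ ()) ]′
    (Partial.filled P y hi<y (<-≤-trans y<hi+½ (half-mono-≤ i<e)))

  -- Runs of the half-cell automaton.

  -- The two flags tell whether the half-cells starting at half i and at
  -- half (suc i) are occupied by the right posts of earlier fences.
  data Pending (i : ℕ) : Bool → Bool → Pred ℚ 0ℓ where
    now  : ∀ {b} → Pending i true b (half i)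
    next : ∀ {b} → Pending i b true (half (suc i))

  -- A run over the `k` half-cells from `half i` on, with flags as in `Pending`. A fence at `i` also
  -- occupies half-cell `i + 2`, which is the second flag once the run has moved to `suc i`; hence
  -- `true` there.
  data Walk : ℕ → ℕ → Bool → Bool → List Tile → Set where
    done   : ∀ {i} → Walk 0 i false false []
    skip   : ∀ {k i b ts} → Walk k (suc i) b false ts → Walk (suc k) i true b ts
    square : ∀ {k i b ts} → Walk k (suc i) b false ts → Walk (suc k) i false b (halfSquare (half i) ∷ ts)
    fence  : ∀ {k i b ts} → Walk k (suc i) b true ts → Walk (suc k) i false b (fence (half i) ∷ ts)

  private
    pending≥ : ∀ {i b} q → Pending i false b q → half (suc i) ≤ q
    pending≥ _ next = ≤-refl

    skip-⊆ : ∀ {i b} → Pending (suc i) b false ⊆ Pending i true b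
    skip-⊆ now = next

    skip-split : ∀ {i b q} → Pending i true b q → q ≡ half i ⊎ Pending (suc i) b false q
    skip-split now  = inj₁ refl
    skip-split next = inj₂ now

    Load : ℕ → Bool → Tile → Pred ℚ 0ℓ
    Load i b t q = q ∈ pieces t ⊎ Pending i false b q

    half-⊆ : ∀ {i b} → Pending (suc i) b false ⊆ Load i b (halfSquare (half i))
    half-⊆ now = inj₂ next

    half-split : ∀ {i b q} → Load i b (halfSquare (half i)) q → q ≡ half i ⊎ Pending (suc i) b false q
    half-split (inj₁ (here eq)) = inj₁ eq
    half-split (inj₂ next)      = inj₂ now

    fence-⊆ : ∀ {i b} → Pending (suc i) b true ⊆ Load i b (fence (half i))
    fence-⊆ now      = inj₂ next
    fence-⊆ {i} next = inj₁ (there (here (half-+1 i)))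

    fence-split : ∀ {i b q} → Load i b (fence (half i)) q → q ≡ half i ⊎ Pending (suc i) b true q
    fence-split (inj₁ (here eq))               = inj₁ eq
    fence-split {i} (inj₁ (there (here refl))) = inj₂ (subst (Pending (suc i) _ true) (half-+1 i) next)
    fence-split (inj₂ next)                    = inj₂ now

    half-apart : ∀ {i b} q → Pending i false b q → PostDisjoint q (halfSquare (half i))
    half-apart {i} _ next y (yq , here yt) = postsDisjoint {half i} ≤-refl y (yt , yq)

    -- A pending post at `half (suc i)` lies exactly in the gap of the new fence.
    fence-apart : ∀ {i b} q → Pending i false b q → PostDisjoint q (fence (half i))
    fence-apart {i} _ next y (yq , here yt)         = postsDisjoint {half i} ≤-refl y (yt , yq)
    fence-apart {i} _ next y (yq , there (here yt)) = postsDisjoint {half (suc i)} (≤-reflexive (half-+1 i)) y (yq , yt)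

  partial⇒walk : ∀ k {i e b c ts} → k ℕ.+ i ≡ e → Partial i e (Pending i b c) ts → Walk k i b c ts
  -- At the right end of the board a pending post would protrude, against `fits`.
  partial⇒walk zero {b = true} refl P = contradiction (Partial.fits P _ now) (<⇒≱ (<+½ _))
  partial⇒walk zero {i} {b = false} {c = true} refl P = contradiction (Partial.fits P _ next) (<⇒≱ (<-trans (<+½ (half i)) (<+½ _)))
  partial⇒walk zero {b = false} {c = false} {ts = []} refl P = done
  partial⇒walk zero {b = false} {c = false} {ts = t ∷ ts} refl P with Partial.contained P
  ... | c ∷ _ = contradiction
    (≤-trans (proj₂ (c _ (lose (leftEnd∈pieces t) (≤+½ _ , ≤-refl)))) (proj₁ (c _ (covers-leftEnd t))))
    (<⇒≱ (<+½ _))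
  partial⇒walk (suc k) {i} {b = true} eq P =
    skip (partial⇒walk k (trans (ℕ.+-suc k i) eq) (skip⇒ now skip-⊆ skip-split P))
  partial⇒walk (suc k) {i} {b = false} {ts = []} refl P =
    contradiction P (nonempty-filling (s≤s (ℕ.m≤n+m i k)) pending≥)
  partial⇒walk (suc k) {i} {b = false} {ts = halfSquare x ∷ ts} refl P
    with refl ← head-leftEnd (s≤s (ℕ.m≤n+m i k)) pending≥ P =
    square (partial⇒walk k (ℕ.+-suc k i) (skip⇒ (inj₁ (here refl)) half-⊆ half-split (unload P)))
  partial⇒walk (suc k) {i} {b = false} {ts = fence x ∷ ts} refl P
    with refl ← head-leftEnd (s≤s (ℕ.m≤n+m i k)) pending≥ P =
    fence (partial⇒walk k (ℕ.+-suc k i) (skip⇒ (inj₁ (here refl)) fence-⊆ fence-split (unload P)))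

  walk⇒partial : ∀ {k i e b c ts} → k ℕ.+ i ≡ e → Walk k i b c ts → Partial i e (Pending i b c) ts
  walk⇒partial {i = i} refl done = record
    { ordered = [] ; disjoint = [] ; contained = [] ; apart = []
    ; filled = λ y hi<y y<hi → contradiction (<⇒≤ (<-trans hi<y y<hi)) (<⇒≱ (<-trans hi<y y<hi))
    ; fits = λ _ () }
  walk⇒partial {suc k} {i} refl (skip w) =
    skip⇐ (s≤s (ℕ.m≤n+m i k)) skip-⊆ now skip-split (walk⇒partial (ℕ.+-suc k i) w)
  walk⇒partial {suc k} {i} refl (square w) =
    load refl half-apart (skip⇐ (s≤s (ℕ.m≤n+m i k)) half-⊆ (inj₁ (here refl)) half-split (walk⇒partial (ℕ.+-suc k i) w))
  walk⇒partial {suc k} {i} refl (fence w) =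
    load refl fence-apart (skip⇐ (s≤s (ℕ.m≤n+m i k)) fence-⊆ (inj₁ (here refl)) fence-split (walk⇒partial (ℕ.+-suc k i) w))

  private
    end : ∀ a l → l * 2 ℕ.+ a * 2 ≡ (a ℕ.+ l) * 2
    end a l = trans (ℕ.+-comm (l * 2) (a * 2)) (sym (ℕ.*-distribʳ-+ 2 a l))

  covers⇒walk : ∀ a l {ts} → ExactlyCovers a (a ℕ.+ l) ts → Walk (l * 2) (a * 2) false false ts
  covers⇒walk a l E = partial⇒walk (l * 2) (end a l) (record
    { ordered   = ordered
    ; disjoint  = disjoint
    ; contained = subst₂ (λ x z → All (λ t → ∀ y → Covers t y → x ≤ y × y ≤ z) _) (fromℕ≡half a) (fromℕ≡half (a ℕ.+ l)) contained
    ; filled    = λ y x<y y<z → inj₂ (filled y (subst (_< y) (sym (fromℕ≡half a)) x<y) (subst (y <_) (sym (fromℕ≡half (a ℕ.+ l))) y<z))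
    ; apart     = All.universal (λ _ _ ()) _
    ; fits      = λ _ ()
    })
    where open ExactlyCovers E

  walk⇒covers : ∀ a l {ts} → Walk (l * 2) (a * 2) false false ts → ExactlyCovers a (a ℕ.+ l) ts
  walk⇒covers a l w = record
    { ordered   = ordered
    ; disjoint  = disjoint
    ; contained = subst₂ (λ x z → All (λ t → ∀ y → Covers t y → x ≤ y × y ≤ z) _) (sym (fromℕ≡half a)) (sym (fromℕ≡half (a ℕ.+ l))) contained
    ; filled    = λ y x<y y<z → [ (λ ()) , (λ p → p) ]′ (filled y (subst (_< y) (fromℕ≡half a) x<y) (subst (y <_) (fromℕ≡half (a ℕ.+ l)) y<z))
    }
    where open Partial (walk⇒partial (end a l) w)

-- From half-cells to cell boundaries.

open HalfCells
open import Data.List.Relation.Binary.Sublist.Propositional using (_⊆_; []; _∷_; _∷ʳ_; minimum)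
open import Data.Nat using (ℕ; zero; suc; _+_; _*_; _∸_; _^_; ⌊_/2⌋; _≤_; _<_; z<s; s<s; parity)
open import Data.Nat.Properties

-- A parity names a half of cell `a` here: `0ℙ` the left one, `1ℙ` the right one.
pos : ℕ → Parity → ℕ
pos a 0ℙ = a * 2
pos a 1ℙ = suc (a * 2)

square-at fence-at : ℕ → Parity → Tile
square-at a s = halfSquare (half (pos a s))
fence-at a s  = fence (half (pos a s))

-- The situation at a cell boundary: either no fence crosses it, or one fence
-- does, the half-cell s of the next cell is still free, and p is the parity of
-- the number of cells since the current metatile began. (When two fences cross
-- the boundary, they fill the next cell, so this need not be a phase.)
data Phase : Set where
  clean  : Phase
  inside : (s p : Parity) → Phase

-- R holds of the parities allowed for the lengths of metatiles.
data Path (R : Pred Parity 0ℓ) : Phase → ℕ → ℕ → List Tile → Set where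
  []     : ∀ {a} → Path R clean a 0 []
  unit   : ∀ {a n ts} → R 1ℙ → Path R clean (suc a) n ts →
           Path R clean a (suc n) (square-at a 0ℙ ∷ square-at a 1ℙ ∷ ts)
  double : ∀ {a n ts} → R 0ℙ → Path R clean (suc (suc a)) n ts →
           Path R clean a (suc (suc n)) (fence-at a 0ℙ ∷ fence-at a 1ℙ ∷ ts)
  open₀  : ∀ {a n ts} → Path R (inside 1ℙ 1ℙ) (suc a) n ts →
           Path R clean a (suc n) (fence-at a 0ℙ ∷ square-at a 1ℙ ∷ ts)
  open₁  : ∀ {a n ts} → Path R (inside 0ℙ 1ℙ) (suc a) n ts →
           Path R clean a (suc n) (square-at a 0ℙ ∷ fence-at a 1ℙ ∷ ts)
  close  : ∀ {s p a n ts} → R (p ⁻¹) → Path R clean (suc a) n ts →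
           Path R (inside s p) a (suc n) (square-at a s ∷ ts)
  extend : ∀ {s p a n ts} → Path R (inside (s ⁻¹) (p ⁻¹)) (suc a) n ts →
           Path R (inside s p) a (suc n) (fence-at a s ∷ ts)

private variable
  R       : Pred Parity 0ℓ
  ph      : Phase
  s p q   : Parity
  a b c m n l : ℕ
  ss ts us vs ms : List Tile

-- Two steps of the walk make one cell. Flags `false true` leave the left half free, `true false`
-- the right half; two fences opened in one cell fill the next cell, which gives `double`. A fence
-- put in the free half blocks that half of the next cell, so the free side alternates.
clean⇒path : ∀ n → Walk (n * 2) (a * 2) false false ts → Path U clean a n ts
free₀⇒path : ∀ n → Walk (n * 2) (a * 2) false true ts → Path U (inside 0ℙ p) a n ts
free₁⇒path : ∀ n → Walk (n * 2) (a * 2) true false ts → Path U (inside 1ℙ p) a n ts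

clean⇒path zero          done                              = []
clean⇒path (suc n)       (square (square w))               = unit _ (clean⇒path n w)
clean⇒path (suc n)       (square (fence w))                = open₁ (free₀⇒path n w)
clean⇒path (suc n)       (fence (square w))                = open₀ (free₁⇒path n w)
clean⇒path (suc (suc n)) (fence (fence (skip (skip w))))   = double _ (clean⇒path n w)

free₀⇒path (suc n) (square (skip w)) = close _ (clean⇒path n w)
free₀⇒path (suc n) (fence (skip w))  = extend (free₁⇒path n w)

free₁⇒path (suc n) (skip (square w)) = close _ (clean⇒path n w)
free₁⇒path (suc n) (skip (fence w))  = extend (free₀⇒path n w)

path⇒clean : Path R clean a n ts → Walk (n * 2) (a * 2) false false ts
path⇒free₀ : Path R (inside 0ℙ p) a n ts → Walk (n * 2) (a * 2) false true ts
path⇒free₁ : Path R (inside 1ℙ p) a n ts → Walk (n * 2) (a * 2) true false ts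

path⇒clean []           = done
path⇒clean (unit _ π)   = square (square (path⇒clean π))
path⇒clean (double _ π) = fence (fence (skip (skip (path⇒clean π))))
path⇒clean (open₀ π)    = fence (square (path⇒free₁ π))
path⇒clean (open₁ π)    = square (fence (path⇒free₀ π))

path⇒free₀ (close _ π) = square (skip (path⇒clean π))
path⇒free₀ (extend π)  = fence (skip (path⇒free₁ π))

path⇒free₁ (close _ π) = skip (square (path⇒clean π))
path⇒free₁ (extend π)  = skip (fence (path⇒free₀ π))

covers⇒path : CoversCells l ts → ∃[ a ] Path U clean a l ts
covers⇒path {l} (a , E) = a , clean⇒path l (covers⇒walk a l E)

path⇒covers : Path R clean a l ts → CoversCells l ts
path⇒covers {a = a} {l} π = a , walk⇒covers a l (path⇒clean π)

-- Where a sublist of a tiling can start.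

-- A record rather than an abbreviation, so that i can be inferred.
record From (i : ℕ) (t : Tile) : Set where
  constructor from
  field
    ≤leftEnd : half i ℚ.≤ leftEnd t

open From

pos≥ : ∀ s → a * 2 ≤ pos a s
pos≥ 0ℙ = ≤-refl
pos≥ 1ℙ = n≤1+n _

pos< : ∀ s → pos a s < suc a * 2
pos< 0ℙ = n≤1+n _
pos< 1ℙ = ≤-refl

from-earlier : c ≤ a → All (From a) ts → All (From c) ts
from-earlier c≤a = All.map λ fr → from (ℚ.≤-trans (half-mono-≤ c≤a) (≤leftEnd fr))

path-from : Path R ph a n ts → All (From (a * 2)) ts
path-from []               = []
path-from (unit _ π)       = from ℚ.≤-refl ∷ from (≤+½ _) ∷ from-earlier (m≤n+m _ 2) (path-from π)
path-from (double _ π)     = from ℚ.≤-refl ∷ from (≤+½ _) ∷ from-earlier (m≤n+m _ 4) (path-from π)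
path-from (open₀ π)        = from ℚ.≤-refl ∷ from (≤+½ _) ∷ from-earlier (m≤n+m _ 2) (path-from π)
path-from (open₁ π)        = from ℚ.≤-refl ∷ from (≤+½ _) ∷ from-earlier (m≤n+m _ 2) (path-from π)
path-from (close {s} _ π)  = from (half-mono-≤ (pos≥ s)) ∷ from-earlier (m≤n+m _ 2) (path-from π)
path-from (extend {s} π)   = from (half-mono-≤ (pos≥ s)) ∷ from-earlier (m≤n+m _ 2) (path-from π)

from-lookup : ∀ {i t} → All (From i) ts → t ∈ ts → ∀ {j} → leftEnd t ≡ half j → i ≤ j
from-lookup {i = i} fr t∈ eq = half-cancel-≤ (subst (half i ℚ.≤_) eq (≤leftEnd (All.lookup fr t∈)))

∷⊆⇒∈ : ∀ {x : Tile} {xs ys} → x ∷ xs ⊆ ys → x ∈ ys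
∷⊆⇒∈ (y ∷ʳ p)  = there (∷⊆⇒∈ p)
∷⊆⇒∈ (eq ∷ p)  = here eq

⊆[]⇒≡[] : ts ⊆ [] → ts ≡ []
⊆[]⇒≡[] [] = refl

-- As `x` starts left of every tile in `ts`, it can only be matched with `y`.
head-agrees : ∀ {i j x y} → leftEnd x ≡ half i → i < j → All (From j) ts → x ∷ ss ⊆ y ∷ ts → x ≡ y × ss ⊆ ts
head-agrees eq i<j fr (_ ∷ʳ p) = contradiction (from-lookup fr (∷⊆⇒∈ p) eq) (<⇒≱ i<j)
head-agrees eq i<j fr (x≡y ∷ p) = x≡y , p

-- The shape of every nonempty path from a clean boundary: no earlier fence reaches its first cell,
-- so a tile starts in both halves.
data Starts (b : ℕ) : List Tile → Set where
  starts : ∀ {x y zs} → leftEnd x ≡ half (b * 2) → leftEnd y ≡ half (suc (b * 2)) → Starts b (x ∷ y ∷ zs)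

clean-starts : Path R clean b (suc n) ts → Starts b ts
clean-starts (unit _ _)   = starts refl refl
clean-starts (double _ _) = starts refl refl
clean-starts (open₀ _)    = starts refl refl
clean-starts (open₁ _)    = starts refl refl

b*2≢1+a*2 : ∀ b a → b * 2 ≢ suc (a * 2)
b*2≢1+a*2 (suc b) (suc a) eq = b*2≢1+a*2 b a (suc-injective (suc-injective eq))

-- A sublist cannot start with `y`: its first left end is in the left half of a cell, that of `y` in
-- the right half.
starts-cell : ∀ {x y} → Starts b ss → leftEnd x ≡ half (a * 2) → leftEnd y ≡ half (suc (a * 2)) →
              ss ⊆ x ∷ y ∷ ts → b ≡ a ⊎ ss ⊆ ts
starts-cell st x≡ y≡ (_ ∷ʳ (_ ∷ʳ p)) = inj₂ p
starts-cell {b} {a = a} (starts z≡ _) x≡ y≡ (_ ∷ʳ (refl ∷ p)) =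
  contradiction (half-injective {b * 2} {suc (a * 2)} (trans (sym z≡) y≡)) (b*2≢1+a*2 b a)
starts-cell {b} {a = a} (starts z≡ _) x≡ y≡ (refl ∷ p) =
  inj₁ (*-cancelʳ-≡ b a 2 (half-injective {b * 2} {a * 2} (trans (sym z≡) x≡)))

-- A cell crossed by one fence contains only one left end, so no tiling starts there.
starts-inside : ∀ {x} s → Starts b ss → leftEnd x ≡ half (pos a s) → All (From (suc a * 2)) ts →
                ss ⊆ x ∷ ts → ss ⊆ ts
starts-inside s st x≡ fr (_ ∷ʳ p) = p
starts-inside {b} {a = a} 0ℙ (starts z≡ w≡) x≡ fr (refl ∷ p)
  with refl ← *-cancelʳ-≡ b a 2 (half-injective {b * 2} {a * 2} (trans (sym z≡) x≡)) =
  contradiction (from-lookup fr (∷⊆⇒∈ p) {suc (b * 2)} w≡) (<⇒≱ ≤-refl)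
starts-inside {b} {a = a} 1ℙ (starts z≡ w≡) x≡ fr (refl ∷ p) =
  contradiction (half-injective {b * 2} {suc (a * 2)} (trans (sym z≡) x≡)) (b*2≢1+a*2 b a)

-- A covering sublist can enter a path only at a clean boundary. Dropping all that comes before
-- leaves a path that starts at the same cell as the sublist, so the two can be compared tile by
-- tile.
cut : Path R ph a n ts → Starts b ss → ss ⊆ ts → ∃[ m ] ∃[ vs ] Path R clean b m vs × ss ⊆ vs
cut [] () []
cut {a = a} π@(unit _ π′) st p with starts-cell {a = a} st refl refl p
... | inj₁ refl = _ , _ , π , p
... | inj₂ p′   = cut π′ st p′
cut {a = a} π@(double _ π′) st p with starts-cell {a = a} st refl refl p
... | inj₁ refl = _ , _ , π , p
... | inj₂ p′   = cut π′ st p′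
cut {a = a} π@(open₀ π′) st p with starts-cell {a = a} st refl refl p
... | inj₁ refl = _ , _ , π , p
... | inj₂ p′   = cut π′ st p′
cut {a = a} π@(open₁ π′) st p with starts-cell {a = a} st refl refl p
... | inj₁ refl = _ , _ , π , p
... | inj₂ p′   = cut π′ st p′
cut (close {s} _ π) st p = cut π st (starts-inside s st refl (path-from π) p)
cut (extend {s} π)  st p = cut π st (starts-inside s st refl (path-from π) p)

-- Metatiles and their minimality.

-- The part of a metatile after its first cell.
data Chain : Parity → ℕ → ℕ → List Tile → Set where
  close  : Chain s a 1 (square-at a s ∷ [])
  extend : Chain (s ⁻¹) (suc a) c us → Chain s a (suc c) (fence-at a s ∷ us)

chain-path : Chain s a c us → Path U (inside s p) a c us
chain-path close      = close _ []
chain-path (extend χ) = extend (chain-path χ)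

chain-no-start : Chain s a c us → Starts b ss → ¬ (ss ⊆ us)
chain-no-start (close {s}) st p with starts-inside s st refl [] p
chain-no-start (close {s}) () p | []
chain-no-start (extend {s} χ) st p =
  -- The choice `0ℙ` is arbitrary, since `U` accepts every parity.
  chain-no-start χ st (starts-inside s st refl (path-from (chain-path {p = 0ℙ} χ)) p)

-- Both sides place a tile in the same free half, and by `head-agrees` the same tile; so the path is
-- forced along the chain up to its closing square, after which no tile is left.
chain-minimal : Chain s a c us → Path U (inside s p) a m ss → ss ⊆ us → ss ≡ us
chain-minimal (close {s}) (close _ π) p = cong (_ ∷_) (⊆[]⇒≡[] (proj₂ (head-agrees refl (pos< s) [] p)))
chain-minimal (close {s}) (extend π)  p with () ← proj₁ (head-agrees refl (pos< s) [] p)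
chain-minimal (extend {s} χ) (close _ π) p
  with () ← proj₁ (head-agrees refl (pos< s) (path-from (chain-path {p = 0ℙ} χ)) p)
chain-minimal (extend {s} χ) (extend π)  p =
  cong (_ ∷_) (chain-minimal χ π (proj₂ (head-agrees refl (pos< s) (path-from (chain-path {p = 0ℙ} χ)) p)))

-- The metatiles of length at least 2.
data Block (a : ℕ) : ℕ → List Tile → Set where
  double : Block a 2 (fence-at a 0ℙ ∷ fence-at a 1ℙ ∷ [])
  open₀  : Chain 1ℙ (suc a) c us → Block a (suc c) (fence-at a 0ℙ ∷ square-at a 1ℙ ∷ us)
  open₁  : Chain 0ℙ (suc a) c us → Block a (suc c) (square-at a 0ℙ ∷ fence-at a 1ℙ ∷ us)

block-path : Block a l ms → Path U clean a l ms
block-path double    = double _ []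
block-path (open₀ χ) = open₀ (chain-path χ)
block-path (open₁ χ) = open₁ (chain-path χ)

block-start : Block a l ms → Starts b ss → ss ⊆ ms → b ≡ a
block-start double st p with starts-cell st refl refl p
block-start double st p | inj₁ b≡a = b≡a
block-start double () p | inj₂ []
block-start (open₀ χ) st p = [ id , (λ p′ → contradiction p′ (chain-no-start χ st)) ]′ (starts-cell st refl refl p)
block-start (open₁ χ) st p = [ id , (λ p′ → contradiction p′ (chain-no-start χ st)) ]′ (starts-cell st refl refl p)

-- Matching on `agree` identifies the first two tiles, which excludes all pairs of different opening
-- constructors.
data Agree : List Tile → List Tile → Set where
  agree : ∀ {x y} → ss ⊆ ts → Agree (x ∷ y ∷ ss) (x ∷ y ∷ ts)

starts-agree : Path R clean a n ts → Starts a ss → ss ⊆ ts → Agree ss ts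
starts-agree {a = a} = go
  where
  step : ∀ {x y x′ y′ ss ts} → leftEnd x ≡ half (a * 2) → leftEnd y ≡ half (suc (a * 2)) →
         leftEnd y′ ≡ half (suc (a * 2)) → All (From (suc a * 2)) ts → x ∷ y ∷ ss ⊆ x′ ∷ y′ ∷ ts →
         Agree (x ∷ y ∷ ss) (x′ ∷ y′ ∷ ts)
  step x≡ y≡ y′≡ fr p
    with refl , p′ ← head-agrees {i = a * 2} x≡ ≤-refl (from (ℚ.≤-reflexive (sym y′≡)) ∷ from-earlier (n≤1+n _) fr) p
    with refl , p″ ← head-agrees {i = suc (a * 2)} y≡ ≤-refl fr p′ = agree p″
  go : Path R clean a n ts → Starts a ss → ss ⊆ ts → Agree ss ts
  go (unit _ π)   (starts x≡ y≡) p = step x≡ y≡ refl (path-from π) p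
  go (double _ π) (starts x≡ y≡) p = step x≡ y≡ refl (from-earlier (m≤n+m _ 2) (path-from π)) p
  go (open₀ π)    (starts x≡ y≡) p = step x≡ y≡ refl (path-from π) p
  go (open₁ π)    (starts x≡ y≡) p = step x≡ y≡ refl (path-from π) p

block-minimal : Block a l ms → Path U clean a (suc m) ss → ss ⊆ ms → ss ≡ ms
block-minimal {a} {l} {ms} {m} {ss} β π p = go β π (starts-agree (block-path β) (clean-starts π) p)
  where
  go : Block a l ms → Path U clean a (suc m) ss → Agree ss ms → ss ≡ ms
  go double    (double _ π) (agree p) = cong (λ us → _ ∷ _ ∷ us) (⊆[]⇒≡[] p)
  go (open₀ χ) (open₀ π)    (agree p) = cong (λ us → _ ∷ _ ∷ us) (chain-minimal χ π p)
  go (open₁ χ) (open₁ π)    (agree p) = cong (λ us → _ ∷ _ ∷ us) (chain-minimal χ π p)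

block-nonempty : Block a l ms → ms ≢ []
block-nonempty double    ()
block-nonempty (open₀ χ) ()
block-nonempty (open₁ χ) ()

-- A nonempty sublist that covers cells is a path; by `block-start` it begins where the block does,
-- and then `block-minimal` makes it the whole block.
block⇒metatile : Block a l ms → IsMetatile l ms
block⇒metatile {a} {l} {ms} β = record
  { nonempty    = block-nonempty β
  ; coversCells = path⇒covers (block-path β)
  ; minimal     = λ ss ss⊆ms ss≢[] (m , C) → let b , π = covers⇒path C in minimal m π ss⊆ms ss≢[]
  }
  where
  minimal : ∀ m → Path U clean b m ss → ss ⊆ ms → ss ≢ [] → ss ≡ ms
  minimal zero    []  ss⊆ms ss≢[] = contradiction refl ss≢[]
  minimal (suc m) π   ss⊆ms ss≢[] with refl ← block-start β (clean-starts π) ss⊆ms = block-minimal β π ss⊆ms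

-- Parities of metatile lengths.

flips : Parity → ℕ → Parity
flips p zero    = p
flips p (suc n) = flips (p ⁻¹) n

-- `flips` accumulates so as to move in step with the parity index of `Path`; two flips cancel.
flips-parity : ∀ n → flips 0ℙ n ≡ parity n
flips-parity zero          = refl
flips-parity (suc zero)    = refl
flips-parity (suc (suc n)) = flips-parity n

Odd : Pred Parity 0ℓ
Odd = _≡ 1ℙ

odd⇒2∤ : ∀ l → Odd (parity l) → ¬ (2 ∣ l)
odd⇒2∤ .(q * 2) odd (divides q refl) = contradiction (trans (sym (even q)) odd) λ ()
  where
  even : ∀ q → parity (q * 2) ≡ 0ℙ
  even zero    = refl
  even (suc q) = even q

2∤⇒odd : ∀ l → ¬ (2 ∣ l) → Odd (parity l)
2∤⇒odd zero          2∤l = contradiction (divides 0 refl) 2∤l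
2∤⇒odd (suc zero)    2∤l = refl
2∤⇒odd (suc (suc l)) 2∤l = 2∤⇒odd l λ (divides q eq) → 2∤l (divides (suc q) (cong (2 +_) eq))

-- The premise on chains remembers how the current metatile was opened: any chain that completes it
-- gives a metatile of odd length. It is used at the closing square, with the one-cell chain.
restrict-inside : Path U (inside s p) a n ts → (∀ {c us} → Chain s a c us → us ⊆ ts → Odd (flips p c)) →
                  NoEvenMetatile ts → Path Odd (inside s p) a n ts
restrict : Path U clean a n ts → NoEvenMetatile ts → Path Odd clean a n ts

tail-noEven : ∀ {t} → NoEvenMetatile (t ∷ ts) → NoEvenMetatile ts
tail-noEven ne l ms p = ne l ms (_ ∷ʳ p)

noEven⇒odd : NoEvenMetatile ts → Block a l ms → ms ⊆ ts → Odd (parity l)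
noEven⇒odd {l = l} ne β p = 2∤⇒odd l (ne _ _ p (block⇒metatile β))

restrict-inside (close _ π) odd ne = close (odd close (refl ∷ minimum _)) (restrict π (tail-noEven ne))
restrict-inside (extend π)  odd ne =
  extend (restrict-inside π (λ χ p → odd (extend χ) (refl ∷ p)) (tail-noEven ne))

restrict []           ne = []
restrict (unit _ π)   ne = unit refl (restrict π (tail-noEven (tail-noEven ne)))
restrict {a = a} (double _ π) ne = contradiction (noEven⇒odd {a = a} ne double (refl ∷ refl ∷ minimum _)) λ ()
restrict (open₀ π)    ne = open₀ (restrict-inside π
  (λ {c} χ p → trans (flips-parity (suc c)) (noEven⇒odd ne (open₀ χ) (refl ∷ refl ∷ p))) (tail-noEven (tail-noEven ne)))
restrict (open₁ π)    ne = open₁ (restrict-inside π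
  (λ {c} χ p → trans (flips-parity (suc c)) (noEven⇒odd ne (open₁ χ) (refl ∷ refl ∷ p))) (tail-noEven (tail-noEven ne)))

empty-length : Path R clean a n [] → n ≡ 0
empty-length [] = refl

-- The tiles of `ms` follow those of the path. At the first closing square of the path a complete
-- chain has been found in `ms`, so by minimality `ms` ends there, where the path records `R` of the
-- length's parity.
inside-minimal-length : Path R (inside s p) a n vs → Path U (inside s q) a l ms → ms ⊆ vs →
                        (∀ {c us} → Chain s a c us → us ⊆ ms → us ≡ ms) → R (flips p l)
inside-minimal-length (close {s} r π) (close _ μ) sub min
  with refl ← min close (refl ∷ minimum _) with refl ← empty-length μ = r
inside-minimal-length (close {s} r π) (extend μ) sub min
  with () ← proj₁ (head-agrees refl (pos< s) (path-from π) sub)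
inside-minimal-length (extend {s} π) (close _ μ) sub min
  with () ← proj₁ (head-agrees refl (pos< s) (path-from π) sub)
inside-minimal-length (extend {s} π) (extend μ) sub min =
  inside-minimal-length π μ (proj₂ (head-agrees refl (pos< s) (path-from π) sub))
    (λ χ p → ∷-injectiveʳ (min (extend χ) (refl ∷ p)))

clean-minimal-length : Path R clean a n vs → Path U clean a (suc l) ms → ms ⊆ vs →
                       (∀ {c us} → Path U clean a (suc c) us → us ⊆ ms → us ≡ ms) → R (flips 0ℙ (suc l))
clean-minimal-length {R} {a} {n} {vs} {l} {ms} π μ sub min = go π μ (starts-agree π (clean-starts μ) sub) min
  where
  go : ∀ {ms} → Path R clean a n vs → Path U clean a (suc l) ms → Agree ms vs →
       (∀ {c us} → Path U clean a (suc c) us → us ⊆ ms → us ≡ ms) → R (flips 0ℙ (suc l))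
  go (unit r π) (unit _ μ) (agree p) min
    with refl ← min (unit _ []) (refl ∷ refl ∷ minimum _) with refl ← empty-length μ = r
  go (double r π) (double _ μ) (agree p) min
    with refl ← min (double _ []) (refl ∷ refl ∷ minimum _) with refl ← empty-length μ = r
  go (open₀ π) (open₀ μ) (agree p) min = inside-minimal-length π μ p
    λ χ q → ∷-injectiveʳ (∷-injectiveʳ (min (open₀ (chain-path χ)) (refl ∷ refl ∷ q)))
  go (open₁ π) (open₁ μ) (agree p) min = inside-minimal-length π μ p
    λ χ q → ∷-injectiveʳ (∷-injectiveʳ (min (open₁ (chain-path χ)) (refl ∷ refl ∷ q)))

-- A metatile among the tiles is itself a path; `cut` aligns the given path with it, and minimality
-- makes its length one of those recorded as odd.
odd⇒noEven : Path Odd ph a n ts → NoEvenMetatile ts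
odd⇒noEven π l ms ms⊆ts M = let b , μ = covers⇒path coversCells in go l μ
  where
  open IsMetatile M
  start-nonempty : Path U clean b (suc c) us → us ≢ []
  start-nonempty {b} π refl with () ← clean-starts π
  go : ∀ l → Path U clean b l ms → ¬ (2 ∣ l)
  go zero    []    = contradiction refl nonempty
  go (suc l) μ with _ , _ , π′ , ms⊆vs ← cut π (clean-starts μ) ms⊆ts =
    odd⇒2∤ (suc l) (trans (sym (flips-parity (suc l))) (clean-minimal-length π′ μ ms⊆vs
      λ ρ us⊆ms → minimal _ us⊆ms (start-nonempty ρ) (_ , path⇒covers ρ)))

tiling⇔path : ∀ n → (IsTiling n ts × NoEvenMetatile ts) ⇔ Path Odd clean 0 n ts
tiling⇔path n = mk⇔
  (λ (tiling , ne) → restrict (clean⇒path n (covers⇒walk 0 n tiling)) ne)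
  (λ π → walk⇒covers 0 n (path⇒clean π) , odd⇒noEven π)

-- Enumeration of the tilings without even metatiles.

tilings     : (a n : ℕ) → List (List Tile)
completions : (s p : Parity) (a n : ℕ) → List (List Tile)

tilings a zero    = [] ∷ []
tilings a (suc n) =
  -- `double` has no counterpart here, as it would require `Odd 0ℙ`.
  map (λ ts → square-at a 0ℙ ∷ square-at a 1ℙ ∷ ts) (tilings (suc a) n) ++
  (map (λ ts → fence-at a 0ℙ ∷ square-at a 1ℙ ∷ ts) (completions 1ℙ 1ℙ (suc a) n) ++
   map (λ ts → square-at a 0ℙ ∷ fence-at a 1ℙ ∷ ts) (completions 0ℙ 1ℙ (suc a) n))

completions s p  a zero    = []
-- After an odd number of cells a closing square would make the length even, so a fence is forced.
completions s 1ℙ a (suc n) = map (fence-at a s ∷_) (completions (s ⁻¹) 0ℙ (suc a) n)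
completions s 0ℙ a (suc n) =
  map (square-at a s ∷_) (tilings (suc a) n) ++ map (fence-at a s ∷_) (completions (s ⁻¹) 1ℙ (suc a) n)

tilings-sound     : ∀ n → ts ∈ tilings a n → Path Odd clean a n ts
completions-sound : ∀ s p n → ts ∈ completions s p a n → Path Odd (inside s p) a n ts

tilings-sound zero (here refl) = []
tilings-sound (suc n) ts∈ with ∈-++⁻ (map _ (tilings _ n)) ts∈
... | inj₁ ts∈₁ with _ , us∈ , refl ← ∈-map⁻ _ ts∈₁ = unit refl (tilings-sound n us∈)
... | inj₂ ts∈₂ with ∈-++⁻ (map _ (completions 1ℙ 1ℙ _ n)) ts∈₂
...   | inj₁ ts∈₃ with _ , us∈ , refl ← ∈-map⁻ _ ts∈₃ = open₀ (completions-sound 1ℙ 1ℙ n us∈)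
...   | inj₂ ts∈₄ with _ , us∈ , refl ← ∈-map⁻ _ ts∈₄ = open₁ (completions-sound 0ℙ 1ℙ n us∈)

completions-sound s 1ℙ (suc n) ts∈ with _ , us∈ , refl ← ∈-map⁻ _ ts∈ = extend (completions-sound (s ⁻¹) 0ℙ n us∈)
completions-sound s 0ℙ (suc n) ts∈ with ∈-++⁻ (map _ (tilings _ n)) ts∈
... | inj₁ ts∈₁ with _ , us∈ , refl ← ∈-map⁻ _ ts∈₁ = close refl (tilings-sound n us∈)
... | inj₂ ts∈₂ with _ , us∈ , refl ← ∈-map⁻ _ ts∈₂ = extend (completions-sound (s ⁻¹) 1ℙ n us∈)

tilings-complete     : Path Odd clean a n ts → ts ∈ tilings a n
completions-complete : Path Odd (inside s p) a n ts → ts ∈ completions s p a n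

tilings-complete []        = here refl
tilings-complete (unit _ π) = ∈-++⁺ˡ (∈-map⁺ _ (tilings-complete π))
tilings-complete {a = a} {n = suc n} (open₀ π) = ∈-++⁺ʳ (map _ (tilings (suc a) n)) (∈-++⁺ˡ (∈-map⁺ _ (completions-complete π)))
tilings-complete {a = a} {n = suc n} (open₁ π) =
  ∈-++⁺ʳ (map _ (tilings (suc a) n)) (∈-++⁺ʳ (map _ (completions 1ℙ 1ℙ (suc a) n)) (∈-map⁺ _ (completions-complete π)))

completions-complete {p = 0ℙ} (close _ π) = ∈-++⁺ˡ (∈-map⁺ _ (tilings-complete π))
completions-complete {p = 0ℙ} {a = a} {n = suc n} (extend π)  = ∈-++⁺ʳ (map _ (tilings (suc a) n)) (∈-map⁺ _ (completions-complete π))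
completions-complete {p = 1ℙ} (extend π)  = ∈-map⁺ _ (completions-complete π)

module _ {f g : List Tile → List Tile} {xss yss : List (List Tile)} (f≢g : ∀ us vs → f us ≢ g vs) where

  map-disjoint : Disjoint (map f xss) (map g yss)
  map-disjoint (ts∈₁ , ts∈₂) with us , _ , ts≡ ← ∈-map⁻ f ts∈₁ | vs , _ , ts≡′ ← ∈-map⁻ g ts∈₂ =
    f≢g us vs (trans (sym ts≡) ts≡′)

tilings-unique     : ∀ a n → Unique (tilings a n)
completions-unique : ∀ s p a n → Unique (completions s p a n)

tilings-unique a zero    = [] ∷ []
tilings-unique a (suc n) = Unique.++⁺
  (Unique.map⁺ (∷-injectiveʳ ∘ ∷-injectiveʳ) (tilings-unique (suc a) n))
  (Unique.++⁺ (Unique.map⁺ (∷-injectiveʳ ∘ ∷-injectiveʳ) (completions-unique 1ℙ 1ℙ (suc a) n))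
              (Unique.map⁺ (∷-injectiveʳ ∘ ∷-injectiveʳ) (completions-unique 0ℙ 1ℙ (suc a) n))
              (map-disjoint λ _ _ ()))
  λ (∈₁ , ∈₂) → [ (λ ∈₃ → map-disjoint (λ _ _ ()) (∈₁ , ∈₃)) , (λ ∈₄ → map-disjoint (λ _ _ ()) (∈₁ , ∈₄)) ]′
    (∈-++⁻ (map _ (completions 1ℙ 1ℙ (suc a) n)) ∈₂)

completions-unique s 0ℙ a zero    = []
completions-unique s 1ℙ a zero    = []
completions-unique s 1ℙ a (suc n) = Unique.map⁺ ∷-injectiveʳ (completions-unique (s ⁻¹) 0ℙ (suc a) n)
completions-unique s 0ℙ a (suc n) = Unique.++⁺
  (Unique.map⁺ ∷-injectiveʳ (tilings-unique (suc a) n))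
  (Unique.map⁺ ∷-injectiveʳ (completions-unique (s ⁻¹) 1ℙ (suc a) n))
  (map-disjoint λ _ _ ())

-- Recurrences for the counts.

oddCompletions : ℕ → ℕ
oddCompletions zero          = 0
oddCompletions (suc zero)    = 0
-- After the forced fence, the next cell either closes the metatile or holds a fence again and
-- restores odd parity.
oddCompletions (suc (suc n)) = T n + oddCompletions n

-- Unfolding `oddCompletions` at `2 + n` gives twice `T n + d`; one `T n` together with `d + d` is
-- `T (suc n)` by induction, and the other `T n` completes the recurrence of `T`.
T-suc : ∀ n → T n + (oddCompletions n + oddCompletions n) ≡ T (suc n)
T-suc zero          = refl
T-suc (suc zero)    = refl
T-suc (suc (suc n)) = begin
  T (2 + n) + (T n + d + (T n + d))   ≡⟨ regroup (T (2 + n)) (T n) d ⟩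
  T (2 + n) + (T n + (d + d)) + T n   ≡⟨ cong (λ x → T (2 + n) + x + T n) (T-suc n) ⟩
  T (2 + n) + T (suc n) + T n         ∎
  where
  open ≡-Reasoning
  d = oddCompletions n
  regroup : ∀ x t d → x + (t + d + (t + d)) ≡ x + (t + (d + d)) + t
  regroup = solve-∀

length-tilings     : ∀ a n → length (tilings a n) ≡ T n
length-completions : ∀ s a n → length (completions s 1ℙ a n) ≡ oddCompletions n

length-tilings a zero    = refl
length-tilings a (suc n) = begin
  length (tilings a (suc n))
    ≡⟨ length-++ (map _ (tilings (suc a) n)) ⟩
  length (map _ (tilings (suc a) n)) + length (map _ (completions 1ℙ 1ℙ (suc a) n) ++ map _ (completions 0ℙ 1ℙ (suc a) n))
    ≡⟨ cong₂ _+_ (trans (length-map _ (tilings (suc a) n)) (length-tilings (suc a) n))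
         (trans (length-++ (map _ (completions 1ℙ 1ℙ (suc a) n)))
           (cong₂ _+_ (trans (length-map _ (completions 1ℙ 1ℙ (suc a) n)) (length-completions 1ℙ (suc a) n))
                      (trans (length-map _ (completions 0ℙ 1ℙ (suc a) n)) (length-completions 0ℙ (suc a) n)))) ⟩
  T n + (oddCompletions n + oddCompletions n)
    ≡⟨ T-suc n ⟩
  T (suc n) ∎
  where open ≡-Reasoning

length-completions s a zero          = refl
length-completions s a (suc zero)    = refl
length-completions s a (suc (suc n)) =
  trans (length-map _ (completions (s ⁻¹) 0ℙ (suc a) (suc n)))
    (trans (length-++ (map _ (tilings (suc (suc a)) n)))
      (cong₂ _+_ (trans (length-map _ (tilings (suc (suc a)) n)) (length-tilings (suc (suc a)) n))
                 (trans (length-map _ (completions (s ⁻¹ ⁻¹) 1ℙ (suc (suc a)) n))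
                   (length-completions (s ⁻¹ ⁻¹) (suc (suc a)) n))))

tilings-count : ∀ n → HasCount (λ ts → IsTiling n ts × NoEvenMetatile ts) (T n)
tilings-count n = tilings 0 n , tilings-unique 0 n , (λ _ → mk⇔
  (Equivalence.from (tiling⇔path n) ∘ tilings-sound n)
  (tilings-complete ∘ Equivalence.to (tiling⇔path n))) , length-tilings 0 n

-- Finite sums.

Σ< : ℕ → (ℕ → ℕ) → ℕ
Σ< n f = sum (applyUpTo f n)

∑-Σ< : ∀ a b f → ∑ a b f ≡ Σ< (suc b ∸ a) (λ i → f (a + i))
∑-Σ< a b f = cong sum (map-upTo (λ i → f (a + i)) (suc b ∸ a))

Σ<-last : ∀ n f → Σ< (suc n) f ≡ Σ< n f + f n
Σ<-last zero    f = +-identityʳ (f 0)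
Σ<-last (suc n) f = trans (cong (f 0 +_) (Σ<-last n (f ∘ suc))) (sym (+-assoc (f 0) _ _))

Σ<-cong : ∀ n {f g} → (∀ i → i < n → f i ≡ g i) → Σ< n f ≡ Σ< n g
Σ<-cong zero    eq = refl
Σ<-cong (suc n) eq = cong₂ _+_ (eq 0 z<s) (Σ<-cong n λ i i<n → eq (suc i) (s<s i<n))

Σ<-*ʳ : ∀ n f c → Σ< n (λ i → f i * c) ≡ Σ< n f * c
Σ<-*ʳ zero    f c = refl
Σ<-*ʳ (suc n) f c = trans (cong (f 0 * c +_) (Σ<-*ʳ n (f ∘ suc) c)) (sym (*-distribʳ-+ c (f 0) _))

Σ<-+ : ∀ n f g → Σ< n (λ i → f i + g i) ≡ Σ< n f + Σ< n g
Σ<-+ zero    f g = refl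
Σ<-+ (suc n) f g = trans (cong (f 0 + g 0 +_) (Σ<-+ n (f ∘ suc) (g ∘ suc))) (interchange (f 0) (g 0) _ _)
  where
  interchange : ∀ a b c d → a + b + (c + d) ≡ a + c + (b + d)
  interchange = solve-∀

-- Squared Fibonacci numbers.

F² : ℕ → ℕ
F² n = F (n + 1) ^ 2

F²-rec : ∀ n → F² (4 + n) + F² n ≡ F² (3 + n) + F² (2 + n) + F² (1 + n) + 3 * F² (2 + n)
-- All terms unfold to polynomials in two consecutive Fibonacci numbers.
F²-rec n = identity (F (n + 1)) (F (suc (n + 1)))
  where
  identity : ∀ x y → (y + x + y + (y + x)) * ((y + x + y + (y + x)) * 1) + x * (x * 1) ≡
             (y + x + y) * ((y + x + y) * 1) + (y + x) * ((y + x) * 1) + y * (y * 1) + 3 * ((y + x) * ((y + x) * 1))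
  identity = solve-∀


-- Convolution with `T`.

module Convolution (G : ℕ → ℕ) where

  conv : ℕ → ℕ
  conv n = Σ< n λ i → G i * T (n ∸ suc i)

  -- The first `n` terms of `conv (k + n)`, with `k` outside the subtraction so that the recurrence
  -- of `T` applies at `k = 3`.
  partial-conv : ℕ → ℕ → ℕ
  partial-conv k n = Σ< n λ i → G i * T (k + (n ∸ suc i))

  shift : ∀ k n → Σ< n (λ i → G i * T (k + n ∸ suc i)) ≡ partial-conv k n
  shift k n = Σ<-cong n λ i i<n → cong (λ m → G i * T m) (+-∸-assoc k i<n)

  peel : ∀ k n → T k ≡ 1 → Σ< (suc n) (λ i → G i * T (suc (k + n) ∸ suc i)) ≡ Σ< n (λ i → G i * T (suc (k + n) ∸ suc i)) + G n
  peel k n Tk≡1 = trans (Σ<-last n term)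
    (cong (Σ< n term +_) (trans (cong (λ m → G n * T m) (m+n∸n≡m k n)) (trans (cong (G n *_) Tk≡1) (*-identityʳ (G n)))))
    where
    term : ℕ → ℕ
    term i = G i * T (suc (k + n) ∸ suc i)

  -- The generating function of `T` is (1 - x^2)/(1 - x - x^2 - x^3), so the recurrence of `T`
  -- acquires the source `G (2 + n)` minus `G n`; the latter is moved to the left to stay in `ℕ`. In
  -- the proof, the terms with `T 0`, `T 1` and `T 2`, all equal to 1, are split off first.
  conv-rec : ∀ n → conv (3 + n) + G n ≡ conv (2 + n) + conv (1 + n) + conv n + G (2 + n)
  conv-rec n = begin
    conv (3 + n) + G n
      ≡⟨ cong (_+ G n) conv₃ ⟩
    P 3 + G n + G (1 + n) + G (2 + n) + G n
      ≡⟨ cong (λ x → x + G n + G (1 + n) + G (2 + n) + G n) P-rec ⟩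
    P 2 + P 1 + P 0 + G n + G (1 + n) + G (2 + n) + G n
      ≡⟨ regroup (P 2) (P 1) (P 0) (G n) (G (1 + n)) (G (2 + n)) ⟩
    (P 2 + G n + G (1 + n)) + (P 1 + G n) + P 0 + G (2 + n)
      ≡⟨ cong₂ (λ x y → x + y + conv n + G (2 + n)) conv₂ conv₁ ⟨
    conv (2 + n) + conv (1 + n) + conv n + G (2 + n) ∎
    where
    open ≡-Reasoning
    P : ℕ → ℕ
    P k = partial-conv k n
    P-rec : P 3 ≡ P 2 + P 1 + P 0
    P-rec = trans (Σ<-cong n λ i _ → distrib (G i) (T (2 + (n ∸ suc i))) (T (1 + (n ∸ suc i))) (T (n ∸ suc i)))
      (trans (Σ<-+ n _ _) (cong (_+ P 0) (Σ<-+ n _ _)))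
      where
      distrib : ∀ g x y z → g * (x + y + z) ≡ g * x + g * y + g * z
      distrib = solve-∀
    conv₁ : conv (1 + n) ≡ P 1 + G n
    conv₁ = trans (peel 0 n refl) (cong (_+ G n) (shift 1 n))
    conv₂ : conv (2 + n) ≡ P 2 + G n + G (1 + n)
    conv₂ = trans (peel 0 (1 + n) refl) (cong (_+ G (1 + n)) (trans (peel 1 n refl) (cong (_+ G n) (shift 2 n))))
    conv₃ : conv (3 + n) ≡ P 3 + G n + G (1 + n) + G (2 + n)
    conv₃ = trans (peel 0 (2 + n) refl) (cong (_+ G (2 + n)) (trans (peel 1 (1 + n) refl)
      (cong (_+ G (1 + n)) (trans (peel 2 n refl) (cong (_+ G n) (shift 3 n))))))
    regroup : ∀ p₂ p₁ p₀ g₀ g₁ g₂ → p₂ + p₁ + p₀ + g₀ + g₁ + g₂ + g₀ ≡ (p₂ + g₀ + g₁) + (p₁ + g₀) + p₀ + g₂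
    regroup = solve-∀

-- The inner sum.

evenTail : ℕ → ℕ
evenTail n = Σ< ⌊ n /2⌋ λ j → 2 * F² (n ∸ 2 * suc j)

-- The inner sum at `k = 2 + n` without its factor `T`. The weights 3 and 2 are the numbers of
-- metatiles of length 2 and of each greater even length.
evenFirst : ℕ → ℕ
evenFirst n = Σ< (suc ⌊ n /2⌋) λ j → (2 + δ (suc j) 1) * F² (2 + n ∸ 2 * suc j)

drop-2 : ∀ n j → F² (2 + n ∸ 2 * suc (suc j)) ≡ F² (n ∸ 2 * suc j)
drop-2 n j = cong (λ m → F² (2 + n ∸ m)) (*-suc 2 (suc j))

evenTail-suc² : ∀ n → evenTail (2 + n) ≡ 2 * F² n + evenTail n
evenTail-suc² n = cong (2 * F² n +_) (Σ<-cong ⌊ n /2⌋ λ j _ → cong (2 *_) (drop-2 n j))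

evenFirst-tail : ∀ n → evenFirst n ≡ 3 * F² n + evenTail n
evenFirst-tail n = cong (3 * F² n +_) (Σ<-cong ⌊ n /2⌋ λ j _ → cong (2 *_) (drop-2 n j))

-- Passing from `n` to `2 + n` adds a leading term of weight 3 and lowers the weight of the old one,
-- `F² n`, from 3 to 2.
evenFirst-rec : ∀ n → evenFirst (2 + n) + F² n ≡ 3 * F² (2 + n) + evenFirst n
evenFirst-rec n = begin
  evenFirst (2 + n) + F² n
    ≡⟨ cong (_+ F² n) (trans (evenFirst-tail (2 + n)) (cong (3 * F² (2 + n) +_) (evenTail-suc² n))) ⟩
  3 * F² (2 + n) + (2 * F² n + evenTail n) + F² n
    ≡⟨ regroup (F² (2 + n)) (F² n) (evenTail n) ⟩
  3 * F² (2 + n) + (3 * F² n + evenTail n)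
    ≡⟨ cong (3 * F² (2 + n) +_) (evenFirst-tail n) ⟨
  3 * F² (2 + n) + evenFirst n ∎
  where
  open ≡-Reasoning
  regroup : ∀ x y z → 3 * x + (2 * y + z) + y ≡ 3 * x + (3 * y + z)
  regroup = solve-∀

-- Comparison of the two sides.

open Convolution evenFirst

F²-conv : ∀ n → F² (suc n) ≡ T (suc n) + conv n
F²-conv zero                = refl
F²-conv (suc zero)          = refl
F²-conv (suc (suc zero))    = refl
-- Both sides are enlarged to avoid subtraction: `F² n` is what `F²-rec` and `evenFirst-rec`
-- require, `g₀` what `conv-rec` requires.
F²-conv (suc (suc (suc n))) = +-cancelʳ-≡ (F² n + g₀) _ _ (begin
  F² (4 + n) + (F² n + g₀)
    ≡⟨ +-assoc (F² (4 + n)) (F² n) g₀ ⟨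
  F² (4 + n) + F² n + g₀
    ≡⟨ cong (_+ g₀) (F²-rec n) ⟩
  F² (3 + n) + F² (2 + n) + F² (1 + n) + 3 * F² (2 + n) + g₀
    ≡⟨ cong (λ x → x + 3 * F² (2 + n) + g₀) (cong₂ _+_ (cong₂ _+_ (F²-conv (suc (suc n))) (F²-conv (suc n))) (F²-conv n)) ⟩
  (T (3 + n) + c₂) + (T (2 + n) + c₁) + (T (1 + n) + c₀) + 3 * F² (2 + n) + g₀
    ≡⟨ regroup (T (3 + n)) (T (2 + n)) (T (1 + n)) c₂ c₁ c₀ (3 * F² (2 + n)) g₀ ⟩
  T (4 + n) + (c₂ + c₁ + c₀ + (3 * F² (2 + n) + g₀))
    ≡⟨ cong (λ x → T (4 + n) + (c₂ + c₁ + c₀ + x)) (evenFirst-rec n) ⟨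
  T (4 + n) + (c₂ + c₁ + c₀ + (evenFirst (2 + n) + F² n))
    ≡⟨ cong (T (4 + n) +_) (+-assoc (c₂ + c₁ + c₀) _ (F² n)) ⟨
  T (4 + n) + (c₂ + c₁ + c₀ + evenFirst (2 + n) + F² n)
    ≡⟨ cong (λ x → T (4 + n) + (x + F² n)) (conv-rec n) ⟨
  T (4 + n) + (conv (3 + n) + g₀ + F² n)
    ≡⟨ regroup′ (T (4 + n)) (conv (3 + n)) g₀ (F² n) ⟩
  T (4 + n) + conv (3 + n) + (F² n + g₀) ∎)
  where
  open ≡-Reasoning
  g₀ = evenFirst n
  c₀ = conv n
  c₁ = conv (1 + n)
  c₂ = conv (2 + n)
  regroup : ∀ t₂ t₁ t₀ c₂ c₁ c₀ f g → (t₂ + c₂) + (t₁ + c₁) + (t₀ + c₀) + f + g ≡ t₂ + t₁ + t₀ + (c₂ + c₁ + c₀ + (f + g))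
  regroup = solve-∀
  regroup′ : ∀ t c g f → t + (c + g + f) ≡ t + c + (f + g)
  regroup′ = solve-∀

summand : ℕ → ℕ → ℕ → ℕ
summand n k j = (2 + δ j 1) * F (k ∸ 2 * j + 1) ^ 2 * T (n ∸ k)

-- With `k = 2 + i` both `⌊ k /2⌋` and `suc n ∸ k` reduce, so only the constant factor has to be
-- taken out of the sum.
inner-sum : ∀ n i → ∑ 1 ⌊ 2 + i /2⌋ (summand (suc n) (2 + i)) ≡ evenFirst i * T (n ∸ suc i)
inner-sum n i = trans (∑-Σ< 1 ⌊ 2 + i /2⌋ (summand (suc n) (2 + i)))
  (Σ<-*ʳ (suc ⌊ i /2⌋) (λ j → (2 + δ (suc j) 1) * F² (2 + i ∸ 2 * suc j)) (T (n ∸ suc i)))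

F²-identity : ∀ n → F (n + 1) ^ 2 ≡ T n + ∑ 2 n (λ k → ∑ 1 ⌊ k /2⌋ (summand n k))
F²-identity zero    = refl
F²-identity (suc n) = trans (F²-conv n) (cong (T (suc n) +_) (sym
  (trans (∑-Σ< 2 (suc n) (λ k → ∑ 1 ⌊ k /2⌋ (summand (suc n) k))) (Σ<-cong n λ i _ → inner-sum n i))))

mainTheorem7 : (n : ℕ) →
    HasCount (λ (ts : List Tile) → IsTiling n ts × NoEvenMetatile ts) (T n)
    × (F (n + 1) ^ 2 ≡ T n + (∑[ k from 2 to n ] (∑[ j from 1 to ⌊ k /2⌋ ] ((2 + δ j 1) * F (k ∸ 2 * j + 1) ^ 2 * T (n ∸ k)))))
mainTheorem7 n = tilings-count n , F²-identity n
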